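{- Let $m\geq 2$ and $n\geq 3$ be integers and let $M$ be the adjacency matrix of the oriented Dutch windmill graph $D^m_n$. Then the Drazin inverse of $M$ is $$M^D=\frac{1}{m}M^{n-1}.$$ Moreover, the only nonzero entries of $M^D$ are equal to $\frac1m$, and they occur precisely at the positions $(i,j)$ satisfying one of the following: (1) $i=1$ and $j=(k-1)(n-1)+n$ for some $k\in\{1,\ldots,m\}$; (2) $i=(k-1)(n-1)+2$ and $j=1$ for some $k\in\{1,\ldots,m\}$; (3) $i=(k-1)(n-1)+\ell$ and $j=i-1$ for some $k\in\{1,\ldots,m\}$ and $\ell\in\{3,\ldots,n\}$; (4) $i=(k-1)(n-1)+\ell$ and $j=(r-1)(n-1)+(\ell-1)$ for some distinct $k,r\in\{1,\ldots,m\}$ and some $\ell\in\{3,\ldots,n\}$. These positions correspond exactly to the ordered pairs of vertices $(i,j)$ such that there is a walk of length $n-1$ from $i$ to $j$ in $D^m_n$.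
   Context: For integers $m\geq 1$, $n\geq 3$, the oriented Dutch windmill graph $D^m_n$ is the directed graph with vertex set $V=\{1,2,\ldots,m(n-1)+1\}$ whose directed edges $(a,b)$ are exactly: $(1,(k-1)(n-1)+2)$ for $k\in\{1,\ldots,m\}$; $((k-1)(n-1)+i,(k-1)(n-1)+i+1)$ for $k\in\{1,\ldots,m\}$ and $i\in\{2,\ldots,n-1\}$; and $((k-1)(n-1)+n,1)$ for $k\in\{1,\ldots,m\}$. (Thus it consists of $m$ directed $n$-cycles sharing the vertex $1$.) Its adjacency matrix $M=(a_{ij})$ is the real $(m(n-1)+1)\times(m(n-1)+1)$ matrix with $a_{ij}=1$ if $(i,j)$ is an edge and $a_{ij}=0$ otherwise. A walk is a sequence of vertices $\langle v_1,\ldots,v_r\rangle$ in which each $(v_t,v_{t+1})$ is an edge; its length is $r-1$. The Drazin inverse of a square matrix $A$ is the unique matrix $X$ with $A^{k+1}X=A^k$, $XAX=X$, $AX=XA$ for some nonnegative integer $k$; the least such $k$ is the Drazin index $\operatorname{ind}(A)$. -}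

module Defs where

open import Algebra.Bundles using (CommutativeRing)
open import Algebra.Structures using (IsCommutativeRing)
open import Data.Bool.Base using (if_then_else_)
open import Data.Fin.Base as Fin using (Fin; toℕ; fromℕ; inject₁)
import Data.Fin.Properties as Fin
open import Data.Integer.Base using (+_)
open import Data.Nat.Base as ℕ using (ℕ; zero; suc; _∸_)
import Data.Nat.Properties as ℕ
open import Data.Product.Base using (_×_; _,_; proj₁; proj₂; ∃-syntax)
open import Data.Rational.Base as ℚ using (ℚ; 0ℚ; 1ℚ; ½)
import Data.Rational.Properties as ℚ
open import Data.Rational.Solver using (module +-*-Solver)
open import Data.Sum.Base using (_⊎_)
open import Data.Vec.Functional using (Vector)
open import Level using (Level; 0ℓ; _⊔_)
open import Relation.Binary.Definitions using (Decidable)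
open import Relation.Binary.PropositionalEquality using (_≡_; _≢_; refl; sym; trans; cong; subst)
open import Relation.Nullary using (Dec; does; map′; _×-dec_; _⊎-dec_)
import Algebra.Definitions.RawMonoid as RawMonoidOps

------------------------------------------------------------------------
-- Real numbers: Cauchy sequences of rationals, with pointwise operations,
-- equal when their difference tends to 0

IsCauchy : (ℕ → ℚ) → Set
IsCauchy x = ∀ ε → 0ℚ ℚ.< ε → ∃[ N ] (∀ p q → N ℕ.≤ p → N ℕ.≤ q → ℚ.∣ x p ℚ.- x q ∣ ℚ.< ε)

record ℝ : Set where
  constructor mkℝ
  field
    seq    : ℕ → ℚ
    cauchy : IsCauchy seq

open ℝ public

infix 4 _≈ℝ_

-- A record, so that both sides can be inferred from the type.
record _≈ℝ_ (x y : ℝ) : Set where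
  constructor mk≈
  field
    close : ∀ ε → 0ℚ ℚ.< ε → ∃[ N ] (∀ p → N ℕ.≤ p → ℚ.∣ seq x p ℚ.- seq y p ∣ ℚ.< ε)

open _≈ℝ_ public

-- Functions that become arbitrarily small along a decreasing family of
-- "tails" of the index type; used with p ≥ N and with p, q ≥ N.
module Smallness {I : Set} (Tail : ℕ → I → Set)
                 (antitone : ∀ {M N i} → M ℕ.≤ N → Tail N i → Tail M i) where

  Small : (I → ℚ) → Set
  Small f = ∀ ε → 0ℚ ℚ.< ε → ∃[ N ] (∀ i → Tail N i → ℚ.∣ f i ∣ ℚ.< ε)

  EventuallyBounded : (I → ℚ) → Set
  EventuallyBounded f = ∃[ B ] (0ℚ ℚ.< B × ∃[ N ] (∀ i → Tail N i → ℚ.∣ f i ∣ ℚ.≤ B))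

  small-resp : ∀ {f g} → (∀ i → f i ≡ g i) → Small f → Small g
  small-resp f≗g s ε ε>0 with s ε ε>0
  ... | N , h = N , λ i t → subst (λ z → ℚ.∣ z ∣ ℚ.< ε) (f≗g i) (h i t)

  small-0 : ∀ {f} → (∀ i → f i ≡ 0ℚ) → Small f
  small-0 f≗0 ε ε>0 = 0 , λ i _ → subst (λ z → ℚ.∣ z ∣ ℚ.< ε) (sym (f≗0 i)) ε>0

  small-neg : ∀ {f} → Small f → Small (λ i → ℚ.- f i)
  small-neg {f} s ε ε>0 with s ε ε>0
  ... | N , h = N , λ i t → subst (ℚ._< ε) (sym (ℚ.∣-p∣≡∣p∣ (f i))) (h i t)

  small-+ : ∀ {f g} → Small f → Small g → Small (λ i → f i ℚ.+ g i)
  small-+ {f} {g} sf sg ε ε>0 = Nf ℕ.⊔ Ng , λ i t →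
    ℚ.≤-<-trans (ℚ.∣p+q∣≤∣p∣+∣q∣ (f i) (g i))
      (subst (ℚ.∣ f i ∣ ℚ.+ ℚ.∣ g i ∣ ℚ.<_) halves
        (ℚ.+-mono-< (proj₂ (sf δ δ>0) i (antitone (ℕ.m≤m⊔n Nf Ng) t))
                    (proj₂ (sg δ δ>0) i (antitone (ℕ.m≤n⊔m Nf Ng) t))))
    where
    δ = ½ ℚ.* ε
    δ>0 : 0ℚ ℚ.< δ
    δ>0 = subst (ℚ._< δ) (ℚ.*-zeroʳ ½) (ℚ.*-monoʳ-<-pos ½ ε>0)
    halves : δ ℚ.+ δ ≡ ε
    halves = trans (sym (ℚ.*-distribʳ-+ ε ½ ½)) (ℚ.*-identityˡ ε)
    Nf = proj₁ (sf δ δ>0)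
    Ng = proj₁ (sg δ δ>0)

  small-* : ∀ {f g} → EventuallyBounded f → Small g → Small (λ i → f i ℚ.* g i)
  small-* {f} {g} (B , B>0 , Nf , f≤B) sg ε ε>0 = Nf ℕ.⊔ Ng , λ i t →
    subst (ℚ._< ε) (sym (ℚ.∣p*q∣≡∣p∣*∣q∣ (f i) (g i)))
      (ℚ.≤-<-trans
        (ℚ.*-monoʳ-≤-nonNeg ℚ.∣ g i ∣ {{ℚ.∣-∣-nonNeg (g i)}} (f≤B i (antitone (ℕ.m≤m⊔n Nf Ng) t)))
        (subst (B ℚ.* ℚ.∣ g i ∣ ℚ.<_) cancel
          (ℚ.*-monoʳ-<-pos B (proj₂ (sg δ δ>0) i (antitone (ℕ.m≤n⊔m Nf Ng) t)))))
    where
    instance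
      posB : ℚ.Positive B
      posB = ℚ.positive B>0
      nzB : ℚ.NonZero B
      nzB = ℚ.pos⇒nonZero B
      pos1/B : ℚ.Positive (ℚ.1/ B)
      pos1/B = ℚ.1/pos⇒pos B
    δ = ℚ.1/ B ℚ.* ε
    δ>0 : 0ℚ ℚ.< δ
    δ>0 = subst (ℚ._< δ) (ℚ.*-zeroʳ (ℚ.1/ B)) (ℚ.*-monoʳ-<-pos (ℚ.1/ B) ε>0)
    cancel : B ℚ.* δ ≡ ε
    cancel = trans (sym (ℚ.*-assoc B (ℚ.1/ B) ε))
               (trans (cong (ℚ._* ε) (ℚ.*-inverseʳ B)) (ℚ.*-identityˡ ε))
    Ng = proj₁ (sg δ δ>0)

private
  open +-*-Solver using (solve; _:=_; _:+_; _:*_; _:-_; :-_)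

  module S₁ = Smallness ℕ._≤_ ℕ.≤-trans
  module S₂ = Smallness {ℕ × ℕ} (λ N i → N ℕ.≤ proj₁ i × N ℕ.≤ proj₂ i)
                        (λ M≤N t → ℕ.≤-trans M≤N (proj₁ t) , ℕ.≤-trans M≤N (proj₂ t))

  toS₂ : ∀ x → IsCauchy x → S₂.Small (λ i → x (proj₁ i) ℚ.- x (proj₂ i))
  toS₂ x c ε ε>0 with c ε ε>0
  ... | N , h = N , λ i t → h (proj₁ i) (proj₂ i) (proj₁ t) (proj₂ t)

  fromS₂ : ∀ x → S₂.Small (λ i → x (proj₁ i) ℚ.- x (proj₂ i)) → IsCauchy x
  fromS₂ x s ε ε>0 with s ε ε>0
  ... | N , h = N , λ p q N≤p N≤q → h (p , q) (N≤p , N≤q)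

  bounded : (x : ℝ) → S₁.EventuallyBounded (seq x)
  bounded x with cauchy x 1ℚ (ℚ.positive⁻¹ 1ℚ)
  ... | N , h = B , ℚ.+-mono-≤-< (ℚ.0≤∣p∣ c) (ℚ.positive⁻¹ 1ℚ) , N , bound
    where
    c = seq x N
    B = ℚ.∣ c ∣ ℚ.+ 1ℚ
    split : ∀ a b → b ℚ.+ (a ℚ.- b) ≡ a
    split = solve 2 (λ a b → b :+ (a :- b) := a) refl
    bound : ∀ p → N ℕ.≤ p → ℚ.∣ seq x p ∣ ℚ.≤ B
    bound p N≤p = subst (λ z → ℚ.∣ z ∣ ℚ.≤ B) (split (seq x p) c)
      (ℚ.≤-trans (ℚ.∣p+q∣≤∣p∣+∣q∣ c (seq x p ℚ.- c))
        (ℚ.+-monoʳ-≤ ℚ.∣ c ∣ (ℚ.<⇒≤ (h p N N≤p ℕ.≤-refl))))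

  on₁ : ∀ {f} → S₁.EventuallyBounded f → S₂.EventuallyBounded (λ i → f (proj₁ i))
  on₁ (B , B>0 , N , h) = B , B>0 , N , λ i t → h (proj₁ i) (proj₁ t)

  on₂ : ∀ {f} → S₁.EventuallyBounded f → S₂.EventuallyBounded (λ i → f (proj₂ i))
  on₂ (B , B>0 , N , h) = B , B>0 , N , λ i t → h (proj₂ i) (proj₂ t)

  +-diff : ∀ a b c d → (a ℚ.- c) ℚ.+ (b ℚ.- d) ≡ (a ℚ.+ b) ℚ.- (c ℚ.+ d)
  +-diff = solve 4 (λ a b c d → (a :- c) :+ (b :- d) := (a :+ b) :- (c :+ d)) refl

  *-diff : ∀ a b c d → a ℚ.* (b ℚ.- d) ℚ.+ d ℚ.* (a ℚ.- c) ≡ a ℚ.* b ℚ.- c ℚ.* d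
  *-diff = solve 4 (λ a b c d → a :* (b :- d) :+ d :* (a :- c) := a :* b :- c :* d) refl

  neg-diff : ∀ a c → ℚ.- (a ℚ.- c) ≡ (ℚ.- a) ℚ.- (ℚ.- c)
  neg-diff = solve 2 (λ a c → :- (a :- c) := (:- a) :- (:- c)) refl

  flip-diff : ∀ a c → ℚ.- (a ℚ.- c) ≡ c ℚ.- a
  flip-diff = solve 2 (λ a c → :- (a :- c) := c :- a) refl

  trans-diff : ∀ a b c → (a ℚ.- b) ℚ.+ (b ℚ.- c) ≡ a ℚ.- c
  trans-diff = solve 3 (λ a b c → (a :- b) :+ (b :- c) := a :- c) refl

  toS₁ : ∀ {x y} → x ≈ℝ y → S₁.Small (λ p → seq x p ℚ.- seq y p)
  toS₁ = close

  fromS₁ : ∀ {x y} → S₁.Small (λ p → seq x p ℚ.- seq y p) → x ≈ℝ y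
  fromS₁ = mk≈

  pointwise : ∀ {x y} → (∀ p → seq x p ≡ seq y p) → x ≈ℝ y
  pointwise {x} {y} e = fromS₁ (S₁.small-0 λ p →
    trans (cong (ℚ._- seq y p) (e p)) (ℚ.+-inverseʳ (seq y p)))

infixl 6 _+ℝ_
infixl 7 _*ℝ_
infix  8 -ℝ_

fromℚ : ℚ → ℝ
fromℚ c = mkℝ (λ _ → c) (fromS₂ (λ _ → c) (S₂.small-0 λ _ → ℚ.+-inverseʳ c))

0ℝ 1ℝ : ℝ
0ℝ = fromℚ 0ℚ
1ℝ = fromℚ 1ℚ

_+ℝ_ _*ℝ_ : ℝ → ℝ → ℝ
x +ℝ y = let z = λ p → seq x p ℚ.+ seq y p in mkℝ z (fromS₂ z
  (S₂.small-resp (λ (p , q) → +-diff (seq x p) (seq y p) (seq x q) (seq y q))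
    (S₂.small-+ (toS₂ (seq x) (cauchy x)) (toS₂ (seq y) (cauchy y)))))
x *ℝ y = let z = λ p → seq x p ℚ.* seq y p in mkℝ z (fromS₂ z
  (S₂.small-resp (λ (p , q) → *-diff (seq x p) (seq y p) (seq x q) (seq y q))
    (S₂.small-+ (S₂.small-* (on₁ (bounded x)) (toS₂ (seq y) (cauchy y)))
                (S₂.small-* (on₂ (bounded y)) (toS₂ (seq x) (cauchy x))))))

-ℝ_ : ℝ → ℝ
-ℝ x = let z = λ p → ℚ.- seq x p in mkℝ z (fromS₂ z
  (S₂.small-resp (λ (p , q) → neg-diff (seq x p) (seq x q)) (S₂.small-neg (toS₂ (seq x) (cauchy x)))))

ℝ-isCommutativeRing : IsCommutativeRing _≈ℝ_ _+ℝ_ _*ℝ_ -ℝ_ 0ℝ 1ℝ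
ℝ-isCommutativeRing = record
  { isRing = record
    { +-isAbelianGroup = record
      { isGroup = record
        { isMonoid = record
          { isSemigroup = record
            { isMagma = record
              { isEquivalence = record
                { refl  = pointwise λ _ → refl
                ; sym   = λ {x} {y} e → fromS₁ (S₁.small-resp
                    (λ p → flip-diff (seq x p) (seq y p)) (S₁.small-neg (toS₁ e)))
                ; trans = λ {x} {y} {z} e f → fromS₁ (S₁.small-resp
                    (λ p → trans-diff (seq x p) (seq y p) (seq z p)) (S₁.small-+ (toS₁ e) (toS₁ f)))
                }
              ; ∙-cong = λ {x} {x′} {y} {y′} e f → fromS₁ (S₁.small-resp
                  (λ p → +-diff (seq x p) (seq y p) (seq x′ p) (seq y′ p))
                  (S₁.small-+ (toS₁ e) (toS₁ f)))
              }
            ; assoc = λ x y z → pointwise λ p → ℚ.+-assoc (seq x p) (seq y p) (seq z p)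
            }
          ; identity = (λ x → pointwise λ p → ℚ.+-identityˡ (seq x p))
                     , (λ x → pointwise λ p → ℚ.+-identityʳ (seq x p))
          }
        ; inverse = (λ x → pointwise λ p → ℚ.+-inverseˡ (seq x p))
                  , (λ x → pointwise λ p → ℚ.+-inverseʳ (seq x p))
        ; ⁻¹-cong = λ {x} {y} e → fromS₁ (S₁.small-resp
            (λ p → neg-diff (seq x p) (seq y p)) (S₁.small-neg (toS₁ e)))
        }
      ; comm = λ x y → pointwise λ p → ℚ.+-comm (seq x p) (seq y p)
      }
    ; *-cong = λ {x} {x′} {y} {y′} e f → fromS₁ (S₁.small-resp
        (λ p → *-diff (seq x p) (seq y p) (seq x′ p) (seq y′ p))
        (S₁.small-+ (S₁.small-* (bounded x) (toS₁ f)) (S₁.small-* (bounded y′) (toS₁ e))))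
    ; *-assoc = λ x y z → pointwise λ p → ℚ.*-assoc (seq x p) (seq y p) (seq z p)
    ; *-identity = (λ x → pointwise λ p → ℚ.*-identityˡ (seq x p))
                 , (λ x → pointwise λ p → ℚ.*-identityʳ (seq x p))
    ; distrib = (λ x y z → pointwise λ p → ℚ.*-distribˡ-+ (seq x p) (seq y p) (seq z p))
              , (λ x y z → pointwise λ p → ℚ.*-distribʳ-+ (seq x p) (seq y p) (seq z p))
    }
  ; *-comm = λ x y → pointwise λ p → ℚ.*-comm (seq x p) (seq y p)
  }

ℝ-commutativeRing : CommutativeRing 0ℓ 0ℓ
ℝ-commutativeRing = record { isCommutativeRing = ℝ-isCommutativeRing }

-- The real number 1/m
recip : (m : ℕ) .{{_ : ℕ.NonZero m}} → ℝ
recip m = fromℚ (+ 1 ℚ./ m)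

------------------------------------------------------------------------
-- Square matrices and the Drazin inverse

module Matrices {c ℓ : Level} (R : CommutativeRing c ℓ) where
  open CommutativeRing R
  open RawMonoidOps +-rawMonoid using (sum)

  Matrix : ℕ → Set c
  Matrix N = Fin N → Fin N → Carrier

  infix  4 _≋_
  infixl 7 _⊗_
  infixr 7 _·_
  infixr 8 _^_

  _≋_ : ∀ {N} → Matrix N → Matrix N → Set ℓ
  A ≋ B = ∀ i j → A i j ≈ B i j

  identity : ∀ {N} → Matrix N
  identity i j = if does (i Fin.≟ j) then 1# else 0#

  _⊗_ : ∀ {N} → Matrix N → Matrix N → Matrix N
  (A ⊗ B) i j = sum (λ k → A i k * B k j)

  _·_ : ∀ {N} → Carrier → Matrix N → Matrix N
  (r · A) i j = r * A i j

  _^_ : ∀ {N} → Matrix N → ℕ → Matrix N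
  A ^ zero  = identity
  A ^ suc k = A ⊗ (A ^ k)

  DrazinEquations : ∀ {N} → Matrix N → Matrix N → ℕ → Set ℓ
  DrazinEquations A X k =
    ((A ^ suc k) ⊗ X ≋ A ^ k) × (X ⊗ A ⊗ X ≋ X) × (A ⊗ X ≋ X ⊗ A)

  -- X is the unique matrix satisfying the equations for some exponent k.
  IsDrazinInverse : ∀ {N} → Matrix N → Matrix N → Set (c ⊔ ℓ)
  IsDrazinInverse {N} A X =
    (∃[ k ] DrazinEquations A X k) ×
    (∀ (Y : Matrix N) → (∃[ k ] DrazinEquations A Y k) → Y ≋ X)

------------------------------------------------------------------------
-- Finite directed graphs

record Digraph (N : ℕ) : Set₁ where
  field
    Edge  : Fin N → Fin N → Set
    edge? : Decidable Edge

-- A walk ⟨v₁,…,vᵣ⟩ of length len = r − 1 with v₁ = i and vᵣ = j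
Walk : ∀ {N} → Digraph N → ℕ → Fin N → Fin N → Set
Walk {N} G len i j =
  ∃[ v ] (v Fin.zero ≡ i × v (fromℕ len) ≡ j × IsWalk v)
  where
  IsWalk : Vector (Fin N) (suc len) → Set
  IsWalk v = ∀ (t : Fin len) → Digraph.Edge G (v (inject₁ t)) (v (Fin.suc t))

adjacencyMatrix : ∀ {N} → Digraph N → Matrices.Matrix ℝ-commutativeRing N
adjacencyMatrix G i j = if does (Digraph.edge? G i j) then 1ℝ else 0ℝ

------------------------------------------------------------------------
-- The oriented Dutch windmill graph

order : ℕ → ℕ → ℕ
order m n = m ℕ.* (n ∸ 1) ℕ.+ 1

infix 4 _∈[_,_]

_∈[_,_] : ℕ → ℕ → ℕ → Set
k ∈[ a , b ] = a ℕ.≤ k × k ℕ.≤ b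

-- Vertices are numbered from 1, elements of Fin N from 0.
label : ∀ {N} → Fin N → ℕ
label i = suc (toℕ i)

-- The number (k−1)(n−1)+i
at : (n k i : ℕ) → ℕ
at n k i = (k ∸ 1) ℕ.* (n ∸ 1) ℕ.+ i

WindmillEdge : (m n a b : ℕ) → Set
WindmillEdge m n a b =
    (∃[ k ] (k ∈[ 1 , m ] × a ≡ 1 × b ≡ at n k 2))
  ⊎ (∃[ k ] (k ∈[ 1 , m ] × ∃[ i ] (i ∈[ 2 , n ∸ 1 ] × a ≡ at n k i × b ≡ at n k i ℕ.+ 1)))
  ⊎ (∃[ k ] (k ∈[ 1 , m ] × a ≡ at n k n × b ≡ 1))

private
  anyIn? : ∀ {P : ℕ → Set} (a b : ℕ) → (∀ k → Dec (P k)) → Dec (∃[ k ] (k ∈[ a , b ] × P k))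
  anyIn? a b P? = map′
    (λ (k , k<1+b , a≤k , p) → k , (a≤k , ℕ.≤-pred k<1+b) , p)
    (λ (k , (a≤k , k≤b) , p) → k , ℕ.s≤s k≤b , a≤k , p)
    (ℕ.anyUpTo? (λ k → (a ℕ.≤? k) ×-dec P? k) (suc b))

windmillEdge? : ∀ m n a b → Dec (WindmillEdge m n a b)
windmillEdge? m n a b =
         anyIn? 1 m (λ k → (a ℕ.≟ 1) ×-dec (b ℕ.≟ at n k 2))
  ⊎-dec  anyIn? 1 m (λ k → anyIn? 2 (n ∸ 1) (λ i → (a ℕ.≟ at n k i) ×-dec (b ℕ.≟ at n k i ℕ.+ 1)))
  ⊎-dec  anyIn? 1 m (λ k → (a ℕ.≟ at n k n) ×-dec (b ℕ.≟ 1))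

windmill : (m n : ℕ) → Digraph (order m n)
windmill m n = record
  { Edge  = λ i j → WindmillEdge m n (label i) (label j)
  ; edge? = λ i j → windmillEdge? m n (label i) (label j)
  }

-- The four families of positions in which the Drazin inverse is nonzero
DrazinPosition : (m n i j : ℕ) → Set
DrazinPosition m n i j =
    (i ≡ 1 × ∃[ k ] (k ∈[ 1 , m ] × j ≡ at n k n))
  ⊎ (∃[ k ] (k ∈[ 1 , m ] × i ≡ at n k 2 × j ≡ 1))
  ⊎ (∃[ k ] ∃[ l ] (k ∈[ 1 , m ] × l ∈[ 3 , n ] × i ≡ at n k l × j ≡ i ∸ 1))
  ⊎ (∃[ k ] ∃[ r ] ∃[ l ] (k ∈[ 1 , m ] × r ∈[ 1 , m ] × k ≢ r × l ∈[ 3 , n ]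
       × i ≡ at n k l × j ≡ at n r (l ∸ 1)))

{-# OPTIONS --safe #-}
-- Multiplication by M replaces a function g on the vertices by the function whose value at a vertex
-- is the sum of g over its out-neighbours. From a non-central vertex there is only one way to go until
-- the centre is reached, and from the centre the n-step walks return exactly once along each of the
-- m cycles, so (Mⁿ g)(1) = m g(1) for every g. Every walk of length n−1 from a non-central vertex meets
-- the centre, whence M²ⁿ⁻¹ = m Mⁿ⁻¹, which yields the Drazin equations for X = (1/m) Mⁿ⁻¹.
-- The same propagation, read in propositions with ∃ in place of Σ, describes the walks; the entries
-- of Mⁿ⁻¹ are 0 or 1 because the end points reached along different cycles are distinct.
module Submission where

open import Defs
open import Algebra.Bundles using (CommutativeRing; Monoid)
import Algebra.Properties.Monoid.Mult as Mult
import Algebra.Properties.Semiring.Sum as Sum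
open import Data.Bool.Base using (if_then_else_)
open import Data.Fin.Base using (Fin; zero; suc; toℕ; fromℕ; fromℕ<; inject₁; cast; combine)
open import Data.Fin.Induction using (<-weakInduction; >-weakInduction)
import Data.Fin.Properties as Fin
open import Data.Fin.Properties using (_≟_)
import Data.Integer.Base as ℤ
import Data.Integer.Properties as ℤ
open import Data.Nat.Base using (ℕ; zero; suc; _+_; _*_; _≤_; _<_; _∸_; z≤n; s≤s; NonZero)
open import Data.Nat.GeneralisedArithmetic using (fold)
import Data.Nat.Properties as ℕ
open import Data.Product.Base using (_×_; _,_; proj₁; proj₂; ∃-syntax)
open import Data.Rational.Base as ℚ using (ℚ; 0ℚ; 1ℚ)
import Data.Rational.Properties as ℚ
import Data.Rational.Unnormalised.Base as ℚᵘ
import Data.Rational.Unnormalised.Properties as ℚᵘ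
open import Data.Sum.Base using (inj₁; inj₂)
import Data.Vec.Functional as Vector
open import Function.Base using (_∘_)
open import Function.Bundles using (_⇔_; mk⇔; Equivalence)
open import Function.Definitions using (Injective)
open import Function.Properties.Equivalence using (⇔-setoid)
open import Level using (Level; 0ℓ)
open import Relation.Binary.Bundles using (Setoid)
open import Relation.Binary.PropositionalEquality as ≡ using (_≡_; _≢_; refl; cong; subst)
import Relation.Binary.Reasoning.Setoid as SetoidReasoning
open import Relation.Nullary using (¬_; Dec; yes; no; does; contradiction)

private variable
  c ℓ : Level

-- Uniqueness of Drazin inverses

module DrazinUniqueness (Mon : Monoid c ℓ) where
  open Monoid Mon hiding (refl)
  open Mult Mon using () renaming (_×_ to _•_)
  open SetoidReasoning setoid

  •-commute : ∀ {a b} → a ∙ b ≈ b ∙ a → ∀ q → (q • a) ∙ b ≈ b ∙ (q • a)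
  •-commute {a} {b} ab≈ba zero    = trans (identityˡ b) (sym (identityʳ b))
  •-commute {a} {b} ab≈ba (suc q) = begin
    (a ∙ q • a) ∙ b   ≈⟨ assoc _ _ _ ⟩
    a ∙ (q • a ∙ b)   ≈⟨ ∙-congˡ (•-commute ab≈ba q) ⟩
    a ∙ (b ∙ q • a)   ≈⟨ assoc _ _ _ ⟨
    (a ∙ b) ∙ q • a   ≈⟨ ∙-congʳ ab≈ba ⟩
    (b ∙ a) ∙ q • a   ≈⟨ assoc _ _ _ ⟩
    b ∙ (a ∙ q • a)   ∎

  module _ {a x : Carrier} (xax≈x : (x ∙ a) ∙ x ≈ x) (ax≈xa : a ∙ x ≈ x ∙ a) where

    -- Commutation turns `xax≈x` into `x = x x a`. Replacing the second `x` by the factorisation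
    -- already found adds one more factor `a`. `divisibleˡ` is the mirror image, from `x = a x x`.
    divisibleʳ : ∀ q → ∃[ u ] (x ≈ u ∙ q • a)
    divisibleʳ zero    = x , sym (identityʳ x)
    divisibleʳ (suc q) with divisibleʳ q
    ... | u , x≈ = x ∙ u , (begin
      x                     ≈⟨ xax≈x ⟨
      (x ∙ a) ∙ x           ≈⟨ assoc _ _ _ ⟩
      x ∙ (a ∙ x)           ≈⟨ ∙-congˡ ax≈xa ⟩
      x ∙ (x ∙ a)           ≈⟨ ∙-congˡ (∙-congʳ x≈) ⟩
      x ∙ ((u ∙ q • a) ∙ a) ≈⟨ ∙-congˡ (assoc _ _ _) ⟩
      x ∙ (u ∙ (q • a ∙ a)) ≈⟨ ∙-congˡ (∙-congˡ (•-commute (Monoid.refl Mon) q)) ⟩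
      x ∙ (u ∙ (a ∙ q • a)) ≈⟨ assoc _ _ _ ⟨
      (x ∙ u) ∙ (a ∙ q • a) ∎)

    divisibleˡ : ∀ q → ∃[ v ] (x ≈ q • a ∙ v)
    divisibleˡ zero    = x , sym (identityˡ x)
    divisibleˡ (suc q) with divisibleˡ q
    ... | v , x≈ = v ∙ x , (begin
      x                     ≈⟨ xax≈x ⟨
      (x ∙ a) ∙ x           ≈⟨ ∙-congʳ ax≈xa ⟨
      (a ∙ x) ∙ x           ≈⟨ ∙-congʳ (∙-congˡ x≈) ⟩
      (a ∙ (q • a ∙ v)) ∙ x ≈⟨ ∙-congʳ (assoc _ _ _) ⟨
      ((a ∙ q • a) ∙ v) ∙ x ≈⟨ assoc _ _ _ ⟩
      (a ∙ q • a) ∙ (v ∙ x) ∎)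

  -- Both elements equal `x a y`. Writing `x` as a multiple of the `l`-th power of `a` lets the
  -- first equation for `y` insert `a y`; writing `y` as a multiple of the `k`-th power lets the one
  -- for `x` absorb `x a`.
  drazin-unique : ∀ {a x y} k l →
    (suc k • a) ∙ x ≈ k • a → (x ∙ a) ∙ x ≈ x → a ∙ x ≈ x ∙ a →
    (suc l • a) ∙ y ≈ l • a → (y ∙ a) ∙ y ≈ y → a ∙ y ≈ y ∙ a →
    x ≈ y
  drazin-unique {a} {x} {y} k l ax xax ax≈xa ay yay ay≈ya
    with divisibleʳ xax ax≈xa l | divisibleˡ yay ay≈ya k
  ... | u , x≈ | v , y≈ = begin
    x                       ≈⟨ x≈ ⟩
    u ∙ l • a               ≈⟨ ∙-congˡ ay ⟨
    u ∙ ((a ∙ l • a) ∙ y)   ≈⟨ ∙-congˡ (∙-congʳ (•-commute (Monoid.refl Mon) l)) ⟨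
    u ∙ ((l • a ∙ a) ∙ y)   ≈⟨ ∙-congˡ (assoc _ _ _) ⟩
    u ∙ (l • a ∙ (a ∙ y))   ≈⟨ assoc _ _ _ ⟨
    (u ∙ l • a) ∙ (a ∙ y)   ≈⟨ ∙-congʳ x≈ ⟨
    x ∙ (a ∙ y)             ≈⟨ ∙-congˡ (∙-congˡ y≈) ⟩
    x ∙ (a ∙ (k • a ∙ v))   ≈⟨ ∙-congˡ (assoc _ _ _) ⟨
    x ∙ ((a ∙ k • a) ∙ v)   ≈⟨ assoc _ _ _ ⟨
    (x ∙ (a ∙ k • a)) ∙ v   ≈⟨ ∙-congʳ (•-commute ax≈xa (suc k)) ⟨
    ((a ∙ k • a) ∙ x) ∙ v   ≈⟨ ∙-congʳ ax ⟩
    k • a ∙ v               ≈⟨ y≈ ⟨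
    y                       ∎

-- Matrices over a commutative ring and their action on vectors

module MatrixProperties (R : CommutativeRing c ℓ) where
  open CommutativeRing R hiding (zero) renaming (refl to ≈-refl; _+_ to _⊹_; _*_ to _✶_)
  open Matrices R
  open Sum semiring using (sum; sum-cong-≋; sum-replicate-zero; ∑-comm; *-distribˡ-sum; *-distribʳ-sum)
  open SetoidReasoning setoid

  infixr 7 _⊛_
  _⊛_ : ∀ {N} → Matrix N → (Fin N → Carrier) → Fin N → Carrier
  (A ⊛ g) i = sum (λ k → A i k ✶ g k)

  ⊛-cong : ∀ {N} (A : Matrix N) {g h : Fin N → Carrier} → (∀ i → g i ≈ h i) → ∀ i → (A ⊛ g) i ≈ (A ⊛ h) i
  ⊛-cong A g≈h i = sum-cong-≋ (λ k → *-congˡ (g≈h k))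

  ⊗-cong : ∀ {N} {A A′ B B′ : Matrix N} → A ≋ A′ → B ≋ B′ → A ⊗ B ≋ A′ ⊗ B′
  ⊗-cong A≋A′ B≋B′ i j = sum-cong-≋ (λ k → *-cong (A≋A′ i k) (B≋B′ k j))

  -- Exchange of the two finite sums. With `g` a column of a third matrix this is associativity of
  -- `⊗`.
  ⊗-⊛ : ∀ {N} (A B : Matrix N) g i → ((A ⊗ B) ⊛ g) i ≈ (A ⊛ (B ⊛ g)) i
  ⊗-⊛ A B g i = begin
    sum (λ k → sum (λ l → A i l ✶ B l k) ✶ g k)       ≈⟨ sum-cong-≋ (λ k → *-distribʳ-sum (g k) (λ l → A i l ✶ B l k)) ⟩
    sum (λ k → sum (λ l → (A i l ✶ B l k) ✶ g k))     ≈⟨ ∑-comm (λ k l → (A i l ✶ B l k) ✶ g k) ⟩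
    sum (λ l → sum (λ k → (A i l ✶ B l k) ✶ g k))     ≈⟨ sum-cong-≋ (λ l → sum-cong-≋ (λ k → *-assoc (A i l) (B l k) (g k))) ⟩
    sum (λ l → sum (λ k → A i l ✶ (B l k ✶ g k)))     ≈⟨ sum-cong-≋ (λ l → *-distribˡ-sum (A i l) (λ k → B l k ✶ g k)) ⟨
    sum (λ l → A i l ✶ sum (λ k → B l k ✶ g k))       ∎

  sum-zero : ∀ {N} (f : Fin N → Carrier) → (∀ i → f i ≈ 0#) → sum f ≈ 0#
  sum-zero {N} f f≈0 = trans (sum-cong-≋ f≈0) (sum-replicate-zero N)

  identity-⊛ : ∀ {N} (g : Fin N → Carrier) i → (identity ⊛ g) i ≈ g i
  identity-⊛ g zero    = begin
    1# ✶ g zero ⊹ sum (λ k → 0# ✶ g (suc k)) ≈⟨ +-cong (*-identityˡ _) (sum-zero _ (λ k → zeroˡ (g (suc k)))) ⟩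
    g zero ⊹ 0#                              ≈⟨ +-identityʳ _ ⟩
    g zero                                   ∎
  identity-⊛ g (suc i) = begin
    -- At two successors `identity` reduces to its entry at the predecessors, so the tail is the
    -- same sum in one dimension less.
    0# ✶ g zero ⊹ (identity ⊛ (g ∘ suc)) i   ≈⟨ +-cong (zeroˡ _) (identity-⊛ (g ∘ suc) i) ⟩
    0# ⊹ g (suc i)                           ≈⟨ +-identityˡ _ ⟩
    g (suc i)                                ∎

  ^-⊛ : ∀ {N} (A : Matrix N) a g i → ((A ^ a) ⊛ g) i ≈ fold g (A ⊛_) a i
  ^-⊛ A zero    g i = identity-⊛ g i
  ^-⊛ A (suc a) g i = trans (⊗-⊛ A (A ^ a) g i) (⊛-cong A (^-⊛ A a g) i)

  -- Makes statements about propagated functions into statements about entries: the function to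
  -- start from is the `j`-th basis vector.
  ^-column : ∀ {N} (A : Matrix N) a i j → (A ^ a) i j ≈ fold (λ x → identity x j) (A ⊛_) a i
  ^-column A zero    i j = ≈-refl
  ^-column A (suc a) i j = ⊛-cong A (λ x → ^-column A a x j) i

  -- The constructor decides `P` and fixes the value of `x` at once, so an entry and a proposition
  -- can be transported together, along an equality and an equivalence.
  data Indicates (x : Carrier) (P : Set) : Set ℓ where
    holds : P → x ≈ 1# → Indicates x P
    fails : ¬ P → x ≈ 0# → Indicates x P

  indicates-dec : ∀ {P} (P? : Dec P) → Indicates (if does P? then 1# else 0#) P
  indicates-dec (yes p) = holds p ≈-refl
  indicates-dec (no ¬p) = fails ¬p ≈-refl

  indicates-resp : ∀ {x y P Q} → x ≈ y → P ⇔ Q → Indicates y Q → Indicates x P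
  indicates-resp x≈y P⇔Q (holds q y≈1)  = holds (Equivalence.from P⇔Q q) (trans x≈y y≈1)
  indicates-resp x≈y P⇔Q (fails ¬q y≈0) = fails (¬q ∘ Equivalence.to P⇔Q) (trans x≈y y≈0)

  module _ {x r : Carrier} {P : Set} (r≉0 : ¬ (r ≈ 0#)) where

    scaled-indicator-value : Indicates x P → ¬ (r ✶ x ≈ 0#) → r ✶ x ≈ r
    scaled-indicator-value (holds _ x≈1) _     = trans (*-congˡ x≈1) (*-identityʳ r)
    scaled-indicator-value (fails _ x≈0) rx≉0 = contradiction (trans (*-congˡ x≈0) (zeroʳ r)) rx≉0

    scaled-indicator-support : Indicates x P → (¬ (r ✶ x ≈ 0#)) ⇔ P
    scaled-indicator-support (holds p x≈1)  = mk⇔ (λ _ → p)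
      (λ _ rx≈0 → r≉0 (trans (sym (trans (*-congˡ x≈1) (*-identityʳ r))) rx≈0))
    scaled-indicator-support (fails ¬p x≈0) = mk⇔
      (λ rx≉0 → contradiction (trans (*-congˡ x≈0) (zeroʳ r)) rx≉0) (λ p → contradiction p ¬p)

  indicates-unique : ∀ {x y P Q} → P ⇔ Q → Indicates x P → Indicates y Q → x ≈ y
  indicates-unique P⇔Q (holds p x≈1)  (holds q y≈1)  = trans x≈1 (sym y≈1)
  indicates-unique P⇔Q (fails ¬p x≈0) (fails ¬q y≈0) = trans x≈0 (sym y≈0)
  indicates-unique P⇔Q (holds p _)    (fails ¬q _)   = contradiction (Equivalence.to P⇔Q p) ¬q
  indicates-unique P⇔Q (fails ¬p _)   (holds q _)    = contradiction (Equivalence.from P⇔Q q) ¬p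

  identity-indicates : ∀ {N} (i j : Fin N) → Indicates (identity i j) (i ≡ j)
  identity-indicates i j = indicates-dec (i ≟ j)

  -- Injectivity leaves at most one nonzero summand: at `j = φ k₀` the summands form row `k₀` of the
  -- identity matrix. This keeps the entries of the power at 0 or 1.
  image-indicates : ∀ {d N} {φ : Fin d → Fin N} → Injective _≡_ _≡_ φ → ∀ j →
    Indicates (sum (λ k → identity (φ k) j)) (∃[ k ] φ k ≡ j)
  image-indicates {φ = φ} φ-inj j with Fin.any? (λ k → φ k ≟ j)
  ... | no ¬∃ = fails ¬∃ (sum-zero _ (λ k →
          -- Here `0#` is regarded as the indicator of the refuted existential.
          indicates-unique (mk⇔ (λ e → k , e) (λ ∃k → contradiction ∃k ¬∃)) (identity-indicates (φ k) j) (fails ¬∃ ≈-refl)))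
  ... | yes (k₀ , refl) = holds (k₀ , refl) (begin
          sum (λ k → identity (φ k) (φ k₀)) ≈⟨ sum-cong-≋ (λ k → trans (same k) (sym (*-identityʳ (identity k₀ k)))) ⟩
          sum (λ k → identity k₀ k ✶ 1#)    ≈⟨ identity-⊛ (λ _ → 1#) k₀ ⟩
          1#                                ∎)
    where
    same : ∀ k → identity (φ k) (φ k₀) ≈ identity k₀ k
    same k = indicates-unique (mk⇔ (≡.sym ∘ φ-inj) (≡.sym ∘ cong φ))
               (identity-indicates (φ k) (φ k₀)) (identity-indicates k₀ k)

  sum-point : ∀ {N} (x g : Fin N → Carrier) y → (∀ j → Indicates (x j) (y ≡ j)) →
    sum (λ j → x j ✶ g j) ≈ g y
  sum-point x g y ind = trans
    (sum-cong-≋ (λ j → *-congʳ (indicates-unique (mk⇔ (λ e → e) (λ e → e)) (ind j) (identity-indicates y j))))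
    (identity-⊛ g y)

  -- The row `x` is a sum of identity rows, one for each `φ k`; after exchanging the sums each of
  -- them evaluates `g` at `φ k`.
  sum-image : ∀ {d N} {φ : Fin d → Fin N} → Injective _≡_ _≡_ φ → (x g : Fin N → Carrier) →
    (∀ j → Indicates (x j) (∃[ k ] φ k ≡ j)) →
    sum (λ j → x j ✶ g j) ≈ sum (λ k → g (φ k))
  sum-image {φ = φ} φ-inj x g ind = begin
    sum (λ j → x j ✶ g j)                            ≈⟨ sum-cong-≋ (λ j → *-congʳ (indicates-unique
                                                          (mk⇔ (λ e → e) (λ e → e)) (ind j) (image-indicates φ-inj j))) ⟩
    sum (λ j → sum (λ k → identity (φ k) j) ✶ g j)   ≈⟨ sum-cong-≋ (λ j → *-distribʳ-sum (g j) (λ k → identity (φ k) j)) ⟩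
    sum (λ j → sum (λ k → identity (φ k) j ✶ g j))   ≈⟨ ∑-comm (λ j k → identity (φ k) j ✶ g j) ⟩
    sum (λ k → sum (λ j → identity (φ k) j ✶ g j))   ≈⟨ sum-cong-≋ (λ k → identity-⊛ g (φ k)) ⟩
    sum (λ k → g (φ k))                              ∎

  -- The matrix monoid and Drazin inverses from powers

  ⊗-identityʳ : ∀ {N} (A : Matrix N) → A ⊗ identity ≋ A
  ⊗-identityʳ A i j = trans
    (sum-cong-≋ (λ k → trans (*-comm (A i k) (identity k j))
      (*-congʳ (indicates-unique (mk⇔ ≡.sym ≡.sym) (identity-indicates k j) (identity-indicates j k)))))
    (identity-⊛ (A i) j)

  ⊗-monoid : ℕ → Monoid c ℓ
  ⊗-monoid N = record
    { Carrier = Matrix N ; _≈_ = _≋_ ; _∙_ = _⊗_ ; ε = identity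
    ; isMonoid = record
      { isSemigroup = record
        { isMagma = record
          { isEquivalence = record
            { refl  = λ i j → ≈-refl
            ; sym   = λ A≋B i j → sym (A≋B i j)
            ; trans = λ A≋B B≋C i j → trans (A≋B i j) (B≋C i j)
            }
          ; ∙-cong = λ {A} {A′} {B} {B′} → ⊗-cong {A = A} {A′} {B} {B′}
          }
        ; assoc = λ A B C i j → ⊗-⊛ A B (λ k → C k j) i
        }
      ; identity = (λ A i j → identity-⊛ (λ k → A k j) i) , ⊗-identityʳ
      }
    }

  module _ {N : ℕ} where
    open Mult (⊗-monoid N) using () renaming (_×_ to _•_)
    open DrazinUniqueness (⊗-monoid N) using (•-commute; drazin-unique)

    •≋^ : ∀ (A : Matrix N) k → k • A ≋ A ^ k
    •≋^ A zero    i j = ≈-refl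
    •≋^ A (suc k) = ⊗-cong {A = A} {A} {k • A} {A ^ k} (λ i j → ≈-refl) (•≋^ A k)

    ^-commute : ∀ (A : Matrix N) k → A ^ k ⊗ A ≋ A ^ suc k
    ^-commute A k i j = begin
      (A ^ k ⊗ A) i j   ≈⟨ ⊗-cong {A = k • A} {A ^ k} {A} {A} (•≋^ A k) (λ i j → ≈-refl) i j ⟨
      ((k • A) ⊗ A) i j ≈⟨ •-commute {A} {A} (λ i j → ≈-refl) k i j ⟩
      (A ⊗ (k • A)) i j ≈⟨ •≋^ A (suc k) i j ⟩
      (A ^ suc k) i j   ∎

    drazin-equations-unique : ∀ {A X Y : Matrix N} k l → DrazinEquations A X k → DrazinEquations A Y l → X ≋ Y
    drazin-equations-unique {A} {X} {Y} k l (ax , xax , ax≈xa) (ay , yay , ay≈ya) =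
      drazin-unique {A} {X} {Y} k l (convert X k ax) xax ax≈xa (convert Y l ay) yay ay≈ya
      where
      convert : ∀ Z q → (A ^ suc q) ⊗ Z ≋ A ^ q → (suc q • A) ⊗ Z ≋ q • A
      convert Z q e i j = begin
        ((suc q • A) ⊗ Z) i j   ≈⟨ ⊗-cong {A = suc q • A} {A ^ suc q} {Z} {Z} (•≋^ A (suc q)) (λ i j → ≈-refl) i j ⟩
        ((A ^ suc q) ⊗ Z) i j   ≈⟨ e i j ⟩
        (A ^ q) i j             ≈⟨ •≋^ A q i j ⟨
        (q • A) i j             ∎

  ⊗-scaleʳ : ∀ {N} r (A B : Matrix N) → A ⊗ (r · B) ≋ r · (A ⊗ B)
  ⊗-scaleʳ r A B i j = trans
    (sum-cong-≋ (λ k → begin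
      A i k ✶ (r ✶ B k j)   ≈⟨ *-assoc _ _ _ ⟨
      (A i k ✶ r) ✶ B k j   ≈⟨ *-congʳ (*-comm _ _) ⟩
      (r ✶ A i k) ✶ B k j   ≈⟨ *-assoc _ _ _ ⟩
      r ✶ (A i k ✶ B k j)   ∎))
    (sym (*-distribˡ-sum r (λ k → A i k ✶ B k j)))

  ⊗-scaleˡ : ∀ {N} r (A B : Matrix N) → (r · A) ⊗ B ≋ r · (A ⊗ B)
  ⊗-scaleˡ r A B i j = trans
    (sum-cong-≋ (λ k → *-assoc r (A i k) (B k j)))
    (sym (*-distribˡ-sum r (λ k → A i k ✶ B k j)))

  -- `s` stands for the number `m` in the ring; `x` is factored out of the `m` equal summands.
  scaled-sum : ∀ m {r s} → sum {m} (λ _ → 1#) ≈ s → r ✶ s ≈ 1# → ∀ x → r ✶ sum {m} (λ _ → x) ≈ x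
  scaled-sum m {r} {s} m≈s rs≈1 x = begin
    r ✶ sum {m} (λ _ → x)         ≈⟨ *-congˡ (sum-cong-≋ {m} (λ _ → *-identityˡ x)) ⟨
    r ✶ sum {m} (λ _ → 1# ✶ x)    ≈⟨ *-congˡ (*-distribʳ-sum {m} x (λ _ → 1#)) ⟨
    r ✶ (sum {m} (λ _ → 1#) ✶ x)  ≈⟨ *-congˡ (*-congʳ m≈s) ⟩
    r ✶ (s ✶ x)                   ≈⟨ *-assoc r s x ⟨
    (r ✶ s) ✶ x                   ≈⟨ *-congʳ rs≈1 ⟩
    1# ✶ x                        ≈⟨ *-identityˡ x ⟩
    x                             ∎

  -- `key` says that `A^(s+1) X = A^s` for `X = r A^s`. Multiplying by `r` gives
  -- `X A X = r A^(s+1) X = r A^s = X`, and `X` commutes with `A` as a multiple of a power of it.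
  scaled-power-drazin : ∀ {N} (A : Matrix N) r s → r · (A ^ suc s ⊗ A ^ s) ≋ A ^ s →
    IsDrazinInverse A (r · A ^ s)
  scaled-power-drazin {N} A r s key = (s , equations) ,
    λ Y (k , eqs) → drazin-equations-unique {A = A} {Y} {X} k s eqs equations
    where
    X = r · A ^ s
    XA≋ : X ⊗ A ≋ r · A ^ suc s
    XA≋ i j = trans (⊗-scaleˡ r (A ^ s) A i j) (*-congˡ (^-commute A s i j))
    equations : DrazinEquations A X s
    equations =
        (λ i j → trans (⊗-scaleʳ r (A ^ suc s) (A ^ s) i j) (key i j))
      , (λ i j → begin
          (X ⊗ A ⊗ X) i j                     ≈⟨ ⊗-cong {A = X ⊗ A} {r · A ^ suc s} {X} {X} XA≋ (λ i j → ≈-refl) i j ⟩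
          ((r · A ^ suc s) ⊗ X) i j           ≈⟨ ⊗-scaleˡ r (A ^ suc s) X i j ⟩
          r ✶ ((A ^ suc s) ⊗ X) i j           ≈⟨ *-congˡ (trans (⊗-scaleʳ r (A ^ suc s) (A ^ s) i j) (key i j)) ⟩
          X i j                               ∎)
      , (λ i j → trans (⊗-scaleʳ r A (A ^ s) i j) (sym (XA≋ i j)))

-- Propagation along the cycles

-- op is either multiplication by the adjacency matrix (with ∑ a sum of reals) or
-- "some out-neighbour satisfies" (with ∑ an existential quantifier).
module _ (S : Setoid c ℓ) where
  open Setoid S

  module Propagation
    {V : Set} {m p : ℕ}
    (centre : V) (spoke : Fin m → Fin (suc p) → V)
    (∑ : (Fin m → Carrier) → Carrier)
    (∑-cong : ∀ {f g} → (∀ k → f k ≈ g k) → ∑ f ≈ ∑ g)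
    (op : (V → Carrier) → V → Carrier)
    (op-cong : ∀ {f g} → (∀ i → f i ≈ g i) → ∀ i → op f i ≈ op g i)
    (op-centre : ∀ g → op g centre ≈ ∑ (λ k → g (spoke k zero)))
    (op-inner : ∀ g k t → op g (spoke k (inject₁ t)) ≈ g (spoke k (suc t)))
    (op-outer : ∀ g k → op g (spoke k (fromℕ p)) ≈ g centre)
    where

    open SetoidReasoning S

    op^ : ℕ → (V → Carrier) → V → Carrier
    op^ a g = fold g op a

    op^-cong : ∀ a {f g} → (∀ i → f i ≈ g i) → ∀ i → op^ a f i ≈ op^ a g i
    op^-cong zero    f≈g = f≈g
    op^-cong (suc a) f≈g = op-cong (op^-cong a f≈g)

    op^-+ : ∀ a b g i → op^ (a + b) g i ≈ op^ a (op^ b g) i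
    op^-+ zero    b g i = Setoid.refl S
    op^-+ (suc a) b g i = op-cong (op^-+ a b g) i

    op^-≡ : ∀ {a b} → a ≡ b → ∀ g i → op^ a g i ≈ op^ b g i
    op^-≡ refl g i = Setoid.refl S

    op^-comm : ∀ a b g i → op^ a (op^ b g) i ≈ op^ b (op^ a g) i
    op^-comm a b g i = begin
      op^ a (op^ b g) i  ≈⟨ op^-+ a b g i ⟨
      op^ (a + b) g i    ≈⟨ op^-≡ (ℕ.+-comm a b) g i ⟩
      op^ (b + a) g i    ≈⟨ op^-+ b a g i ⟩
      op^ b (op^ a g) i  ∎

    -- The last step of the walk is absorbed into the function, so the induction needs `g` to vary.
    outward : ∀ k t g → op^ (toℕ t) g (spoke k zero) ≈ g (spoke k t)
    outward k = <-weakInduction _ (λ g → Setoid.refl S) λ t ih g → begin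
      op^ (suc (toℕ t)) g (spoke k zero)           ≈⟨ op^-comm 1 (toℕ t) g _ ⟩
      op^ (toℕ t) (op g) (spoke k zero)            ≈⟨ op^-≡ (Fin.toℕ-inject₁ t) (op g) _ ⟨
      op^ (toℕ (inject₁ t)) (op g) (spoke k zero)  ≈⟨ ih (op g) ⟩
      op g (spoke k (inject₁ t))                   ≈⟨ op-inner g k t ⟩
      g (spoke k (suc t))                          ∎

    -- `suc p ∸ toℕ t` is the distance to the centre, so the induction runs backwards from the
    -- outermost vertex, which is one step away.
    inward : ∀ k t g → op^ (suc p ∸ toℕ t) g (spoke k t) ≈ g centre
    inward k = >-weakInduction _
      (λ g → trans (op^-≡ one g _) (op-outer g k))
      (λ t ih g → begin
        op^ (suc p ∸ toℕ (inject₁ t)) g (spoke k (inject₁ t)) ≈⟨ op^-≡ (step t) g _ ⟩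
        op (op^ (p ∸ toℕ t) g) (spoke k (inject₁ t))          ≈⟨ op-inner _ k t ⟩
        op^ (p ∸ toℕ t) g (spoke k (suc t))                   ≈⟨ ih g ⟩
        g centre                                              ∎)
      where
      one : suc p ∸ toℕ (fromℕ p) ≡ 1
      one = ≡.trans (cong (suc p ∸_) (Fin.toℕ-fromℕ p)) (ℕ.m+n∸n≡m 1 p)
      step : ∀ (t : Fin p) → suc p ∸ toℕ (inject₁ t) ≡ suc (p ∸ toℕ t)
      step t = ≡.trans (cong (suc p ∸_) (Fin.toℕ-inject₁ t)) (ℕ.+-∸-assoc 1 (ℕ.<⇒≤ (Fin.toℕ<n t)))

    from-centre : ∀ t g → op^ (suc (toℕ t)) g centre ≈ ∑ (λ k → g (spoke k t))
    from-centre t g = trans (op-centre _) (∑-cong (λ k → outward k t g))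

    -- Of the `n − 1 = suc p` steps, `suc p ∸ toℕ t` are spent reaching the centre, and `toℕ t`
    -- remain.
    through-centre : ∀ k t g → op^ (suc p) g (spoke k t) ≈ op^ (toℕ t) g centre
    through-centre k t g = begin
      op^ (suc p) g (spoke k t)                        ≈⟨ op^-≡ (ℕ.m∸n+n≡m (ℕ.<⇒≤ (Fin.toℕ<n t))) g _ ⟨
      op^ (suc p ∸ toℕ t + toℕ t) g (spoke k t)        ≈⟨ op^-+ (suc p ∸ toℕ t) (toℕ t) g _ ⟩
      op^ (suc p ∸ toℕ t) (op^ (toℕ t) g) (spoke k t)  ≈⟨ inward k t _ ⟩
      op^ (toℕ t) g centre                             ∎

    round-centre : ∀ g → op^ (suc p) g centre ≈ ∑ (λ k → g (spoke k (fromℕ p)))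
    round-centre g = trans (op^-≡ (cong suc (≡.sym (Fin.toℕ-fromℕ p))) g _) (from-centre (fromℕ p) g)

    -- The `toℕ t + 1` steps left at the centre lead into an arbitrary spoke, ending one place
    -- before the starting place.
    round-suc : ∀ k t g → op^ (suc p) g (spoke k (suc t)) ≈ ∑ (λ r → g (spoke r (inject₁ t)))
    round-suc k t g = begin
      op^ (suc p) g (spoke k (suc t))        ≈⟨ through-centre k (suc t) g ⟩
      op^ (suc (toℕ t)) g centre             ≈⟨ op^-≡ (cong suc (≡.sym (Fin.toℕ-inject₁ t))) g _ ⟩
      op^ (suc (toℕ (inject₁ t))) g centre   ≈⟨ from-centre (inject₁ t) g ⟩
      ∑ (λ r → g (spoke r (inject₁ t)))      ∎

    -- The first step chooses a cycle, and the other `n − 1` steps are forced and close it.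
    return : ∀ g → op^ (suc (suc p)) g centre ≈ ∑ (λ _ → g centre)
    return g = trans (op-centre _) (∑-cong (λ k → through-centre k zero g))

    twice-round-centre : ∀ g → op^ (suc (suc p)) (op^ (suc p) g) centre ≈ ∑ (λ _ → op^ (suc p) g centre)
    twice-round-centre g = return (op^ (suc p) g)

    -- Commuting the two blocks puts the `n − 1` steps first. They meet the centre, where the block
    -- of `n` steps can be evaluated by `return`.
    twice-round-spoke : ∀ k t g →
      op^ (suc (suc p)) (op^ (suc p) g) (spoke k t) ≈ ∑ (λ _ → op^ (suc p) g (spoke k t))
    twice-round-spoke k t g = begin
      op^ (suc (suc p)) (op^ (suc p) g) (spoke k t)  ≈⟨ op^-comm (suc (suc p)) (suc p) g _ ⟩
      op^ (suc p) (op^ (suc (suc p)) g) (spoke k t)  ≈⟨ through-centre k t _ ⟩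
      op^ (toℕ t) (op^ (suc (suc p)) g) centre       ≈⟨ op^-comm (toℕ t) (suc (suc p)) g _ ⟩
      op^ (suc (suc p)) (op^ (toℕ t) g) centre       ≈⟨ return (op^ (toℕ t) g) ⟩
      ∑ (λ _ → op^ (toℕ t) g centre)                 ≈⟨ ∑-cong (λ _ → through-centre k t g) ⟨
      ∑ (λ _ → op^ (suc p) g (spoke k t))            ∎

-- Walks

module Walks {N : ℕ} (G : Digraph N) where
  open Digraph G

  ◇ : (Fin N → Set) → Fin N → Set
  ◇ P i = ∃[ x ] (Edge i x × P x)

  ◇-cong : ∀ {P Q} → (∀ i → P i ⇔ Q i) → ∀ i → ◇ P i ⇔ ◇ Q i
  ◇-cong P⇔Q i = mk⇔ (λ (x , e , p) → x , e , Equivalence.to (P⇔Q x) p)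
                      (λ (x , e , q) → x , e , Equivalence.from (P⇔Q x) q)

  -- Splitting off the first edge of a vertex sequence corresponds to the outermost `◇`.
  walk⇔◇ : ∀ len i j → Walk G len i j ⇔ fold (_≡ j) ◇ len i
  walk⇔◇ len i j = mk⇔ (to len i) (from len i)
    where
    to : ∀ len i → Walk G len i j → fold (_≡ j) ◇ len i
    to zero      i (v , refl , refl , _) = refl
    to (suc len) i (v , refl , refl , w) =
      v (suc zero) , w zero , to len _ (v ∘ suc , refl , refl , w ∘ suc)
    from : ∀ len i → fold (_≡ j) ◇ len i → Walk G len i j
    from zero      i refl = (λ _ → i) , refl , refl , λ ()
    from (suc len) i (x , e , r) with from len x r
    ... | v , refl , last , w = (i Vector.∷ v) , refl , last , λ { zero → e ; (suc t) → w t }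

-- The windmill with cycles of length n = p + 2

module Windmill (m p : ℕ) where
  n N : ℕ
  n = suc (suc p)
  N = order m n

  open Digraph (windmill m n) using (Edge)
  open Walks (windmill m n)

  -- `order` adds its 1 on the right, so `N` does not reduce to a successor; the cast makes `zero`
  -- the centre and `suc` all other vertices.
  shift : suc (m * suc p) ≡ N
  shift = ℕ.+-comm 1 (m * suc p)

  centre : Fin N
  centre = cast shift zero

  -- The vertex (k−1)(n−1)+l of the paper is spoke (k−1) (l−2).
  spoke : Fin m → Fin (suc p) → Fin N
  spoke k t = cast shift (suc (combine k t))

  label-injective : ∀ {i j : Fin N} → label i ≡ label j → i ≡ j
  label-injective e = Fin.toℕ-injective (ℕ.suc-injective e)

  label-centre : label centre ≡ 1
  label-centre = cong suc (Fin.toℕ-cast shift zero)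

  -- The place is given through an equation because `toℕ` of `inject₁ t` or `fromℕ p` does not
  -- reduce.
  label-spoke : ∀ k t {l} → toℕ t ≡ l → label (spoke k t) ≡ at n (suc (toℕ k)) (2 + l)
  label-spoke k t refl = begin
    suc (toℕ (cast shift (suc (combine k t))))  ≡⟨ cong suc (Fin.toℕ-cast shift (suc (combine k t))) ⟩
    2 + toℕ (combine k t)                       ≡⟨ cong (2 +_) (Fin.toℕ-combine k t) ⟩
    2 + (suc p * toℕ k + toℕ t)                 ≡⟨ cong (λ x → 2 + (x + toℕ t)) (ℕ.*-comm (suc p) (toℕ k)) ⟩
    2 + (toℕ k * suc p + toℕ t)                 ≡⟨ cong suc (ℕ.+-suc _ _) ⟨
    1 + (toℕ k * suc p + suc (toℕ t))           ≡⟨ ℕ.+-suc _ _ ⟨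
    toℕ k * suc p + (2 + toℕ t)                 ∎
    where open ≡.≡-Reasoning

  ≡centre : ∀ {i : Fin N} → label i ≡ 1 → i ≡ centre
  ≡centre e = label-injective (≡.trans e (≡.sym label-centre))

  ≡spoke : ∀ {i : Fin N} k t {l} → toℕ t ≡ l → label i ≡ at n (suc (toℕ k)) (2 + l) → i ≡ spoke k t
  ≡spoke k t t≡l e = label-injective (≡.trans e (≡.sym (label-spoke k t t≡l)))

  cast-injective : ∀ {i j} → cast shift i ≡ cast shift j → i ≡ j
  cast-injective {i} {j} e = Fin.toℕ-injective
    (≡.trans (≡.sym (Fin.toℕ-cast shift i)) (≡.trans (cong toℕ e) (Fin.toℕ-cast shift j)))

  spoke-injective : ∀ {k t k′ t′} → spoke k t ≡ spoke k′ t′ → k ≡ k′ × t ≡ t′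
  spoke-injective {k} {t} {k′} {t′} e = Fin.combine-injective k t k′ t′ (Fin.suc-injective (cast-injective e))

  centre≢spoke : ∀ {k t} → centre ≢ spoke k t
  centre≢spoke e with cast-injective e
  ... | ()

  data Vertex : Fin N → Set where
    isCentre : Vertex centre
    isSpoke  : ∀ k t → Vertex (spoke k t)

  vertex : ∀ i → Vertex i
  vertex i = subst Vertex (Fin.cast-involutive shift (≡.sym shift) i) (go (cast (≡.sym shift) i))
    where
    go : ∀ x → Vertex (cast shift x)
    go zero    = isCentre
    go (suc x) with Fin.combine-surjective {m} {suc p} x
    ... | k , t , refl = isSpoke k t

  -- Turns a numerical range into a finite index: `a` is 1 for blades, 2 for the edges inside a
  -- blade, and 3 for the last two families of positions.
  offset : ∀ a {l b} → a ≤ l → l < a + b → ∃[ t ] (l ≡ a + toℕ {b} t)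
  offset zero    _         l<b       = fromℕ< l<b , ≡.sym (Fin.toℕ-fromℕ< l<b)
  offset (suc a) (s≤s a≤l) (s≤s l<b) with offset a a≤l l<b
  ... | t , e = t , cong suc e

  blade : ∀ {k} → k ∈[ 1 , m ] → ∃[ k′ ] (k ≡ suc (toℕ {m} k′))
  blade (1≤k , k≤m) = offset 1 1≤k (s≤s k≤m)

  blade∈ : (k : Fin m) → suc (toℕ k) ∈[ 1 , m ]
  blade∈ k = s≤s z≤n , Fin.toℕ<n k

  -- Edges described by blade and place

  at-suc : ∀ k l → at n k l + 1 ≡ at n k (suc l)
  at-suc k l = ≡.trans (ℕ.+-comm _ 1) (≡.sym (ℕ.+-suc _ l))

  at-pred : ∀ k l → at n k (suc l) ∸ 1 ≡ at n k l
  at-pred k l = cong (_∸ 1) (ℕ.+-suc _ l)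

  -- End points enter through equations, so that case analysis at a fixed source need not unify
  -- `cast` terms. The target equations have the shape used by `image-indicates`.
  data Arrow (i j : Fin N) : Set where
    out   : ∀ k → i ≡ centre → spoke k zero ≡ j → Arrow i j
    along : ∀ k t → i ≡ spoke k (inject₁ t) → spoke k (suc t) ≡ j → Arrow i j
    back  : ∀ k → i ≡ spoke k (fromℕ p) → centre ≡ j → Arrow i j

  edge⇒arrow : ∀ {i j} → Edge i j → Arrow i j
  edge⇒arrow (inj₁ (k , k∈ , i≡ , j≡)) with blade k∈
  ... | k′ , refl = out k′ (≡centre i≡) (≡.sym (≡spoke k′ zero refl j≡))
  edge⇒arrow (inj₂ (inj₁ (k , k∈ , l , (2≤l , l≤) , i≡ , j≡))) with blade k∈ | offset 2 2≤l (s≤s l≤)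
  ... | k′ , refl | t , refl = along k′ t (≡spoke k′ (inject₁ t) (Fin.toℕ-inject₁ t) i≡)
          (≡.sym (≡spoke k′ (suc t) refl (≡.trans j≡ (at-suc k (2 + toℕ t)))))
  edge⇒arrow (inj₂ (inj₂ (k , k∈ , i≡ , j≡))) with blade k∈
  ... | k′ , refl = back k′ (≡spoke k′ (fromℕ p) (Fin.toℕ-fromℕ p) i≡) (≡.sym (≡centre j≡))

  arrow⇒edge : ∀ {i j} → Arrow i j → Edge i j
  arrow⇒edge (out k refl refl) = inj₁ (_ , blade∈ k , label-centre , label-spoke k zero refl)
  arrow⇒edge (along k t refl refl) = inj₂ (inj₁ (_ , blade∈ k , 2 + toℕ t , (s≤s (s≤s z≤n) , s≤s (Fin.toℕ<n t)) ,
    label-spoke k (inject₁ t) (Fin.toℕ-inject₁ t) ,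
    ≡.trans (label-spoke k (suc t) refl) (≡.sym (at-suc (suc (toℕ k)) (2 + toℕ t)))))
  arrow⇒edge (back k refl refl) = inj₂ (inj₂ (_ , blade∈ k , label-spoke k (fromℕ p) (Fin.toℕ-fromℕ p) , label-centre))

  edge-centre : ∀ j → Edge centre j ⇔ (∃[ k ] spoke k zero ≡ j)
  edge-centre j = mk⇔ (to ∘ edge⇒arrow) (λ (k , e) → arrow⇒edge (out k refl e))
    where
    to : Arrow centre j → ∃[ k ] spoke k zero ≡ j
    to (out k _ e)     = k , e
    to (along _ _ e _) = contradiction e centre≢spoke
    to (back _ e _)    = contradiction e centre≢spoke

  edge-inner : ∀ k t j → Edge (spoke k (inject₁ t)) j ⇔ spoke k (suc t) ≡ j
  edge-inner k t j = mk⇔ (λ e → to (edge⇒arrow e) refl) (λ e → arrow⇒edge (along k t refl e))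
    where
    to : ∀ {i} → Arrow i j → i ≡ spoke k (inject₁ t) → spoke k (suc t) ≡ j
    to (out _ e _)       i≡ = contradiction (≡.trans (≡.sym e) i≡) centre≢spoke
    to (along k′ t′ e f) i≡ with spoke-injective (≡.trans (≡.sym i≡) e)
    ... | refl , t≡ with Fin.inject₁-injective t≡
    ... | refl = f
    to (back k′ e _)     i≡ with spoke-injective (≡.trans (≡.sym i≡) e)
    ... | _ , t≡ = contradiction (≡.sym t≡) Fin.fromℕ≢inject₁

  edge-outer : ∀ k j → Edge (spoke k (fromℕ p)) j ⇔ centre ≡ j
  edge-outer k j = mk⇔ (to ∘ edge⇒arrow) (λ e → arrow⇒edge (back k refl e))
    where
    to : Arrow (spoke k (fromℕ p)) j → centre ≡ j
    to (out _ e _)     = contradiction (≡.sym e) centre≢spoke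
    to (along _ _ e _) = contradiction (proj₂ (spoke-injective e)) Fin.fromℕ≢inject₁
    to (back _ _ f)    = f

  -- `fromLater` allows `r` to equal `k` and so merges the last two families of `DrazinPosition`;
  -- deciding `k ≟ r` separates them again.
  data Position (i j : Fin N) : Set where
    fromCentre : ∀ k → i ≡ centre → spoke k (fromℕ p) ≡ j → Position i j
    fromFirst  : ∀ k → i ≡ spoke k zero → centre ≡ j → Position i j
    fromLater  : ∀ k t r → i ≡ spoke k (suc t) → spoke r (inject₁ t) ≡ j → Position i j

  drazinPosition⇒position : ∀ {i j} → DrazinPosition m n (label i) (label j) → Position i j
  drazinPosition⇒position (inj₁ (i≡ , k , k∈ , j≡)) with blade k∈
  ... | k′ , refl = fromCentre k′ (≡centre i≡) (≡.sym (≡spoke k′ (fromℕ p) (Fin.toℕ-fromℕ p) j≡))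
  drazinPosition⇒position (inj₂ (inj₁ (k , k∈ , i≡ , j≡))) with blade k∈
  ... | k′ , refl = fromFirst k′ (≡spoke k′ zero refl i≡) (≡.sym (≡centre j≡))
  drazinPosition⇒position (inj₂ (inj₂ (inj₁ (k , l , k∈ , (3≤l , l≤n) , i≡ , j≡))))
    with blade k∈ | offset 3 3≤l (s≤s l≤n)
  ... | k′ , refl | t , refl = fromLater k′ t k′ (≡spoke k′ (suc t) refl i≡)
    (≡.sym (≡spoke k′ (inject₁ t) (Fin.toℕ-inject₁ t)
      (≡.trans j≡ (≡.trans (cong (_∸ 1) i≡) (at-pred k (2 + toℕ t))))))
  drazinPosition⇒position (inj₂ (inj₂ (inj₂ (k , r , l , k∈ , r∈ , _ , (3≤l , l≤n) , i≡ , j≡))))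
    with blade k∈ | blade r∈ | offset 3 3≤l (s≤s l≤n)
  ... | k′ , refl | r′ , refl | t , refl = fromLater k′ t r′ (≡spoke k′ (suc t) refl i≡)
    (≡.sym (≡spoke r′ (inject₁ t) (Fin.toℕ-inject₁ t) j≡))

  position⇒drazinPosition : ∀ {i j} → Position i j → DrazinPosition m n (label i) (label j)
  position⇒drazinPosition (fromCentre k refl refl) =
    inj₁ (label-centre , _ , blade∈ k , label-spoke k (fromℕ p) (Fin.toℕ-fromℕ p))
  position⇒drazinPosition (fromFirst k refl refl) =
    inj₂ (inj₁ (_ , blade∈ k , label-spoke k zero refl , label-centre))
  position⇒drazinPosition (fromLater k t r refl refl) with k ≟ r
  ... | yes refl = inj₂ (inj₂ (inj₁ (_ , 3 + toℕ t , blade∈ k , (s≤s (s≤s (s≤s z≤n)) , s≤s (s≤s (Fin.toℕ<n t))) ,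
          label-spoke k (suc t) refl ,
          ≡.trans (label-spoke k (inject₁ t) (Fin.toℕ-inject₁ t))
            (≡.sym (≡.trans (cong (_∸ 1) (label-spoke k (suc t) refl)) (at-pred (suc (toℕ k)) (2 + toℕ t)))))))
  ... | no k≢r = inj₂ (inj₂ (inj₂ (_ , _ , 3 + toℕ t , blade∈ k , blade∈ r ,
          k≢r ∘ Fin.toℕ-injective ∘ ℕ.suc-injective , (s≤s (s≤s (s≤s z≤n)) , s≤s (s≤s (Fin.toℕ<n t))) ,
          label-spoke k (suc t) refl , label-spoke r (inject₁ t) (Fin.toℕ-inject₁ t))))

  -- Reachability in `n − 1` steps

  open Equivalence using (to; from)

  ∃-cong : ∀ {P Q : Fin m → Set} → (∀ k → P k ⇔ Q k) → (∃[ k ] P k) ⇔ (∃[ k ] Q k)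
  ∃-cong P⇔Q = mk⇔ (λ (k , p) → k , to (P⇔Q k) p) (λ (k , q) → k , from (P⇔Q k) q)

  ◇-centre : ∀ P → ◇ P centre ⇔ (∃[ k ] P (spoke k zero))
  ◇-centre P = mk⇔ (λ (x , e , q) → let k , k≡ = to (edge-centre x) e in k , subst P (≡.sym k≡) q)
                    (λ (k , q) → spoke k zero , from (edge-centre _) (k , refl) , q)

  ◇-inner : ∀ P k t → ◇ P (spoke k (inject₁ t)) ⇔ P (spoke k (suc t))
  ◇-inner P k t = mk⇔ (λ (x , e , q) → subst P (≡.sym (to (edge-inner k t x) e)) q)
                       (λ q → _ , from (edge-inner k t _) refl , q)

  ◇-outer : ∀ P k → ◇ P (spoke k (fromℕ p)) ⇔ P centre
  ◇-outer P k = mk⇔ (λ (x , e , q) → subst P (≡.sym (to (edge-outer k x) e)) q)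
                     (λ q → _ , from (edge-outer k _) refl , q)

  module Reach = Propagation (⇔-setoid 0ℓ) {m = m} centre spoke
    (λ P → ∃[ k ] P k) ∃-cong ◇ ◇-cong ◇-centre ◇-inner ◇-outer

  -- Each kind of starting vertex matches one constructor: the centre leads to the last vertices, a
  -- first vertex to the centre, and a later vertex one place back on any blade.
  position⇔◇ : ∀ i j → Position i j ⇔ Reach.op^ (suc p) (_≡ j) i
  position⇔◇ i j = mk⇔ ⇒ (⇐ (vertex i))
    where
    ⇒ : Position i j → Reach.op^ (suc p) (_≡ j) i
    ⇒ (fromCentre k refl e)    = from (Reach.round-centre (_≡ j)) (k , e)
    ⇒ (fromFirst k refl e)     = from (Reach.through-centre k zero (_≡ j)) e
    ⇒ (fromLater k t r refl e) = from (Reach.round-suc k t (_≡ j)) (r , e)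
    ⇐ : ∀ {i} → Vertex i → Reach.op^ (suc p) (_≡ j) i → Position i j
    ⇐ isCentre            w = let k , e = to (Reach.round-centre (_≡ j)) w in fromCentre k refl e
    ⇐ (isSpoke k zero)    w = fromFirst k refl (to (Reach.through-centre k zero (_≡ j)) w)
    ⇐ (isSpoke k (suc t)) w = let r , e = to (Reach.round-suc k t (_≡ j)) w in fromLater k t r refl e

  drazinPosition⇔walk : ∀ i j → DrazinPosition m n (label i) (label j) ⇔ Walk (windmill m n) (suc p) i j
  drazinPosition⇔walk i j = mk⇔
    (from (walk⇔◇ (suc p) i j) ∘ to (position⇔◇ i j) ∘ drazinPosition⇒position)
    (position⇒drazinPosition ∘ from (position⇔◇ i j) ∘ to (walk⇔◇ (suc p) i j))

  -- Entries of powers of the adjacency matrix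

  spoke-injectiveˡ : ∀ t → Injective _≡_ _≡_ (λ k → spoke k t)
  spoke-injectiveˡ t e = proj₁ (spoke-injective e)

  module Counting (R : CommutativeRing c ℓ)
    (M : Matrices.Matrix R N)
    (M-indicates-Edge : ∀ i j → MatrixProperties.Indicates R (M i j) (Edge i j)) where
    open CommutativeRing R using (Carrier; _≈_; setoid; semiring; *-congˡ; 1#; trans) renaming (refl to ≈-refl; _*_ to _✶_)
    open MatrixProperties R
    open Matrices R
    open Sum semiring using (sum; sum-cong-≋)

    M-indicates : ∀ {P : Fin N → Set} i → (∀ j → Edge i j ⇔ P j) → ∀ j → Indicates (M i j) (P j)
    M-indicates i E⇔P j = indicates-resp ≈-refl (mk⇔ (from (E⇔P j)) (to (E⇔P j))) (M-indicates-Edge i j)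

    ⊛-centre : ∀ g → (M ⊛ g) centre ≈ sum (λ k → g (spoke k zero))
    ⊛-centre g = sum-image (spoke-injectiveˡ zero) (M centre) g (M-indicates centre edge-centre)

    ⊛-inner : ∀ g k t → (M ⊛ g) (spoke k (inject₁ t)) ≈ g (spoke k (suc t))
    ⊛-inner g k t = sum-point (M _) g _ (M-indicates _ (edge-inner k t))

    ⊛-outer : ∀ g k → (M ⊛ g) (spoke k (fromℕ p)) ≈ g centre
    ⊛-outer g k = sum-point (M _) g _ (M-indicates _ (edge-outer k))

    module Count = Propagation setoid {m = m} centre spoke
      sum sum-cong-≋ (M ⊛_) (⊛-cong M) ⊛-centre ⊛-inner ⊛-outer

    -- The same propagation law is applied to sums (`Count`) and to existentials (`Reach`); at the
    -- end an identity entry, or a sum over an injective family of end points, indicates the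
    -- resulting proposition.
    power-indicates : ∀ i j → Indicates ((M ^ suc p) i j) (DrazinPosition m n (label i) (label j))
    power-indicates i j = indicates-resp (^-column M (suc p) i j)
      (mk⇔ (to (position⇔◇ i j) ∘ drazinPosition⇒position) (position⇒drazinPosition ∘ from (position⇔◇ i j)))
      (go (vertex i))
      where
      e : Fin N → Carrier
      e x = identity x j
      go : ∀ {i} → Vertex i → Indicates (Count.op^ (suc p) e i) (Reach.op^ (suc p) (_≡ j) i)
      go isCentre            = indicates-resp (Count.round-centre e) (Reach.round-centre (_≡ j))
                                 (image-indicates (spoke-injectiveˡ (fromℕ p)) j)
      go (isSpoke k zero)    = indicates-resp (Count.through-centre k zero e) (Reach.through-centre k zero (_≡ j))
                                 (identity-indicates centre j)
      go (isSpoke k (suc t)) = indicates-resp (Count.round-suc k t e) (Reach.round-suc k t (_≡ j))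
                                 (image-indicates (spoke-injectiveˡ (inject₁ t)) j)

    -- The relation `M^(2n−1) = m M^(n−1)`, read off from column `j` by propagating a basis vector.
    power-repeats : ∀ i j → (M ^ suc (suc p) ⊗ M ^ suc p) i j ≈ sum {m} (λ _ → (M ^ suc p) i j)
    power-repeats i j = begin
      (M ^ suc (suc p) ⊗ M ^ suc p) i j                   ≈⟨ ^-⊛ M (suc (suc p)) (λ x → (M ^ suc p) x j) i ⟩
      Count.op^ (suc (suc p)) (λ x → (M ^ suc p) x j) i   ≈⟨ Count.op^-cong (suc (suc p)) (λ x → ^-column M (suc p) x j) i ⟩
      Count.op^ (suc (suc p)) (Count.op^ (suc p) e) i     ≈⟨ go (vertex i) ⟩
      sum {m} (λ _ → Count.op^ (suc p) e i)               ≈⟨ sum-cong-≋ {m} (λ _ → ^-column M (suc p) i j) ⟨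
      sum {m} (λ _ → (M ^ suc p) i j)                     ∎
      where
      open SetoidReasoning setoid
      e : Fin N → Carrier
      e x = identity x j
      go : ∀ {i} → Vertex i →
        Count.op^ (suc (suc p)) (Count.op^ (suc p) e) i ≈ sum {m} (λ _ → Count.op^ (suc p) e i)
      go isCentre      = Count.twice-round-centre e
      go (isSpoke k t) = Count.twice-round-spoke k t e

    drazin : ∀ {r s} → sum {m} (λ _ → 1#) ≈ s → r ✶ s ≈ 1# → IsDrazinInverse M (r · M ^ suc p)
    drazin {r} m≈s rs≈1 = scaled-power-drazin M r (suc p) λ i j →
      trans (*-congˡ (power-repeats i j)) (scaled-sum m m≈s rs≈1 _)

-- The theorem over a commutative ring in which `m` is invertible

module WindmillDrazin (R : CommutativeRing c ℓ) where
  open CommutativeRing R using (_≈_; semiring; 0#; 1#) renaming (_*_ to _✶_)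
  open MatrixProperties R
  open Matrices R
  open Sum semiring using (sum)

  windmill-drazin : ∀ m n → 3 ≤ n → (M : Matrix (order m n)) →
    (∀ i j → Indicates (M i j) (Digraph.Edge (windmill m n) i j)) →
    ∀ r s → sum {m} (λ _ → 1#) ≈ s → r ✶ s ≈ 1# → ¬ (r ≈ 0#) →
    ∀ {X} → Matrices._·_ R r (Matrices._^_ R M (n ∸ 1)) ≡ X →
    IsDrazinInverse M X
    × (∀ i j → ¬ (X i j ≈ 0#) → X i j ≈ r)
    × (∀ i j → (¬ (X i j ≈ 0#)) ⇔ DrazinPosition m n (label i) (label j))
    × (∀ i j → DrazinPosition m n (label i) (label j) ⇔ Walk (windmill m n) (n ∸ 1) i j)
  windmill-drazin m (suc (suc p)) (s≤s (s≤s _)) M ind r s m≈s rs≈1 r≉0 refl =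
      drazin m≈s rs≈1
    , (λ i j → scaled-indicator-value r≉0 (power-indicates i j))
    , (λ i j → scaled-indicator-support r≉0 (power-indicates i j))
    , Windmill.drazinPosition⇔walk m p
    where open Windmill.Counting m p R M ind

-- The real number 1/m

module Reciprocal where
  open CommutativeRing ℝ-commutativeRing using (semiring) renaming (_*_ to _✶_)
  open Sum semiring using (sum)

  fromℚ-≈ : ∀ (x : ℝ) q → (∀ p → seq x p ≡ q) → x ≈ℝ fromℚ q
  fromℚ-≈ x q x≡q = mk≈ λ ε ε>0 → 0 , λ p _ →
    subst (λ z → ℚ.∣ z ∣ ℚ.< ε) (≡.sym (≡.trans (cong (ℚ._- q) (x≡q p)) (ℚ.+-inverseʳ q))) ε>0

  fromℕℚ : ℕ → ℚ
  fromℕℚ k = ℤ.+ k ℚ./ 1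

  -- Normalisation of fractions is stuck on a variable, so the identity is checked on unnormalised
  -- fractions, where it is integer arithmetic.
  1+fromℕℚ : ∀ k → 1ℚ ℚ.+ fromℕℚ k ≡ fromℕℚ (suc k)
  1+fromℕℚ k = ℚ.toℚᵘ-injective (begin
    ℚ.toℚᵘ (1ℚ ℚ.+ fromℕℚ k)                ≈⟨ ℚ.toℚᵘ-homo-+ 1ℚ (fromℕℚ k) ⟩
    ℚᵘ.1ℚᵘ ℚᵘ.+ ℚ.toℚᵘ (fromℕℚ k)           ≈⟨ ℚᵘ.+-congʳ ℚᵘ.1ℚᵘ (ℚ.toℚᵘ-fromℚᵘ (ℚᵘ.mkℚᵘ (ℤ.+ k) 0)) ⟩
    ℚᵘ.1ℚᵘ ℚᵘ.+ ℚᵘ.mkℚᵘ (ℤ.+ k) 0           ≈⟨ ℚᵘ.*≡* (cong (λ z → (ℤ.+ 1 ℤ.+ z) ℤ.* ℤ.+ 1) (ℤ.*-identityʳ (ℤ.+ k))) ⟩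
    ℚᵘ.mkℚᵘ (ℤ.+ suc k) 0                   ≈⟨ ℚ.toℚᵘ-fromℚᵘ (ℚᵘ.mkℚᵘ (ℤ.+ suc k) 0) ⟨
    ℚ.toℚᵘ (fromℕℚ (suc k))                 ∎)
    where open SetoidReasoning ℚᵘ.≃-setoid

  seq-sum-1 : ∀ k q → seq (sum {k} (λ _ → 1ℝ)) q ≡ fromℕℚ k
  seq-sum-1 zero    q = refl
  seq-sum-1 (suc k) q = ≡.trans (cong (1ℚ ℚ.+_) (seq-sum-1 k q)) (1+fromℕℚ k)

  sum-1 : ∀ k → sum {k} (λ _ → 1ℝ) ≈ℝ fromℚ (fromℕℚ k)
  sum-1 k = fromℚ-≈ _ (fromℕℚ k) (seq-sum-1 k)

  recip-positive : ∀ m .{{_ : NonZero m}} → 0ℚ ℚ.< ℤ.+ 1 ℚ./ m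
  recip-positive m = ℚ.positive⁻¹ _ {{ℚ.normalize-pos 1 m}}

  -- Closeness to 0 tested at `ε = 1/m` would give `1/m < 1/m`.
  recip-≉0 : ∀ m .{{_ : NonZero m}} → ¬ (recip m ≈ℝ 0ℝ)
  recip-≉0 m (mk≈ cl) with cl (ℤ.+ 1 ℚ./ m) (recip-positive m)
  ... | N , h = ℚ.<-irrefl
    (≡.trans (cong ℚ.∣_∣ (ℚ.+-identityʳ _)) (ℚ.0≤p⇒∣p∣≡p (ℚ.<⇒≤ (recip-positive m))))
    (h N ℕ.≤-refl)

  1/m*m : ∀ m .{{_ : NonZero m}} → (ℤ.+ 1 ℚ./ m) ℚ.* fromℕℚ m ≡ 1ℚ
  1/m*m (suc k) = ℚ.toℚᵘ-injective (begin
    ℚ.toℚᵘ ((ℤ.+ 1 ℚ./ suc k) ℚ.* fromℕℚ (suc k))            ≈⟨ ℚ.toℚᵘ-homo-* (ℤ.+ 1 ℚ./ suc k) (fromℕℚ (suc k)) ⟩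
    ℚ.toℚᵘ (ℤ.+ 1 ℚ./ suc k) ℚᵘ.* ℚ.toℚᵘ (fromℕℚ (suc k))    ≈⟨ ℚᵘ.*-cong (ℚ.toℚᵘ-fromℚᵘ (ℚᵘ.mkℚᵘ (ℤ.+ 1) k))
                                                                           (ℚ.toℚᵘ-fromℚᵘ (ℚᵘ.mkℚᵘ (ℤ.+ suc k) 0)) ⟩
    -- The second factor is, by computation, the reciprocal of the first.
    ℚᵘ.mkℚᵘ (ℤ.+ 1) k ℚᵘ.* ℚᵘ.mkℚᵘ (ℤ.+ suc k) 0             ≈⟨ ℚᵘ.*-inverseʳ (ℚᵘ.mkℚᵘ (ℤ.+ 1) k) ⟩
    ℚᵘ.1ℚᵘ                                                   ∎)
    where open SetoidReasoning ℚᵘ.≃-setoid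

  ✶-fromℚ-inverse : ∀ r a b → (∀ p → seq r p ≡ a) → a ℚ.* b ≡ 1ℚ → r ✶ fromℚ b ≈ℝ 1ℝ
  ✶-fromℚ-inverse r a b r≡a ab≡1 = fromℚ-≈ (r ✶ fromℚ b) 1ℚ (λ p → ≡.trans (cong (ℚ._* b) (r≡a p)) ab≡1)

  recip-inverse : ∀ m .{{m≢0 : NonZero m}} → recip m ✶ fromℚ (fromℕℚ m) ≈ℝ 1ℝ
  recip-inverse m {{m≢0}} =
    ✶-fromℚ-inverse (recip m {{m≢0}}) (ℚ._/_ (ℤ.+ 1) m {{m≢0}}) (fromℕℚ m) (λ _ → refl) (1/m*m m {{m≢0}})

-- The theorem over the real numbers

open Matrices ℝ-commutativeRing using (Matrix; _·_; _^_; IsDrazinInverse)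

-- Comparing two real matrix expressions that are not syntactically equal makes Agda normalise the
-- Cauchy proofs of all the products in them, which takes too long. Hence windmill-drazin takes the
-- Drazin inverse up to a propositional equality, the opened _·_ and _^_ are related one at a time to
-- those of Matrices, the let-bound terms have their types inferred, and instances are explicit.
^-unfold : ∀ {N} (A : Matrix N) k → Matrices._^_ ℝ-commutativeRing A k ≡ A ^ k
^-unfold A k = refl

·-unfold : ∀ {N} r {A B : Matrix N} → A ≡ B → Matrices._·_ ℝ-commutativeRing r A ≡ r · B
·-unfold r refl = refl

·-^-unfold : ∀ {N} r (A : Matrix N) k →
  Matrices._·_ ℝ-commutativeRing r (Matrices._^_ ℝ-commutativeRing A k) ≡ r · (A ^ k)
·-^-unfold r A k = let e = ·-unfold r (^-unfold A k) in e

module _ (m n : ℕ) (3≤n : 3 ≤ n) (M : Matrix (order m n))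
  (ind : ∀ i j → MatrixProperties.Indicates ℝ-commutativeRing (M i j) (Digraph.Edge (windmill m n) i j))
  (r s : ℝ) (m≈s : Sum.sum (CommutativeRing.semiring ℝ-commutativeRing) {m} (λ _ → 1ℝ) ≈ℝ s)
  (rs≈1 : CommutativeRing._*_ ℝ-commutativeRing r s ≈ℝ 1ℝ) (r≉0 : ¬ (r ≈ℝ 0ℝ)) where

  ℝ-windmill-drazin′ : ∀ {X} → Matrices._·_ ℝ-commutativeRing r (Matrices._^_ ℝ-commutativeRing M (n ∸ 1)) ≡ X →
    IsDrazinInverse M X
    × (∀ i j → ¬ (X i j ≈ℝ 0ℝ) → X i j ≈ℝ r)
    × (∀ i j → (¬ (X i j ≈ℝ 0ℝ)) ⇔ DrazinPosition m n (label i) (label j))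
    × (∀ i j → DrazinPosition m n (label i) (label j) ⇔ Walk (windmill m n) (n ∸ 1) i j)
  ℝ-windmill-drazin′ = WindmillDrazin.windmill-drazin ℝ-commutativeRing m n 3≤n M ind r s m≈s rs≈1 r≉0

  ℝ-windmill-drazin :
    IsDrazinInverse M (r · (M ^ (n ∸ 1)))
    × (∀ i j → ¬ ((r · (M ^ (n ∸ 1))) i j ≈ℝ 0ℝ) → (r · (M ^ (n ∸ 1))) i j ≈ℝ r)
    × (∀ i j → (¬ ((r · (M ^ (n ∸ 1))) i j ≈ℝ 0ℝ)) ⇔ DrazinPosition m n (label i) (label j))
    × (∀ i j → DrazinPosition m n (label i) (label j) ⇔ Walk (windmill m n) (n ∸ 1) i j)
  ℝ-windmill-drazin = let e = ·-^-unfold r M (n ∸ 1); d = ℝ-windmill-drazin′ e in d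

theorem3p3 : (m n : ℕ) .{{_ : NonZero m}} → 2 ≤ m → 3 ≤ n →
    let M : Matrix (order m n)
        M = adjacencyMatrix (windmill m n)
        Mᴰ : Matrix (order m n)
        Mᴰ = recip m · (M ^ (n ∸ 1))
    in IsDrazinInverse M Mᴰ
       × (∀ i j → ¬ (Mᴰ i j ≈ℝ 0ℝ) → Mᴰ i j ≈ℝ recip m)
       × (∀ i j → (¬ (Mᴰ i j ≈ℝ 0ℝ)) ⇔ DrazinPosition m n (label i) (label j))
       × (∀ i j → DrazinPosition m n (label i) (label j) ⇔ Walk (windmill m n) (n ∸ 1) i j)
theorem3p3 m n {{m≢0}} _ 3≤n = ℝ-windmill-drazin m n 3≤n (adjacencyMatrix (windmill m n))
  (λ i j → indicates-dec (Digraph.edge? (windmill m n) i j))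
  (recip m {{m≢0}}) (fromℚ (fromℕℚ m)) (sum-1 m) (recip-inverse m {{m≢0}}) (recip-≉0 m {{m≢0}})
  where
  open MatrixProperties ℝ-commutativeRing using (indicates-dec)
  open Reciprocal
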